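{- For every tree $T$ with $\ell$ leaves, $$\vec{\mathcal{D}}(T) = \left(\tfrac{1}{2}+o(1)\right)\ell,$$ where $o(1)$ denotes a quantity depending only on $\ell$ that tends to $0$ as $\ell\to\infty$, uniformly over all trees with $\ell$ leaves.
   Context: A subtree $T'$ of a tree $T$ is a connected subset of its edges (trees identified with edge sets). For subtrees $T'\subseteq T$ and orientations $\sigma$ of the edges of $T$ and $\sigma'$ of the edges of $T'$, let $d_{T,T'}^{\sigma,\sigma'}\colon E(T')\to\{ -1,1\}$ be $1$ on edges where $\sigma$ and $\sigma'$ agree and $-1$ otherwise. Let $\mathcal O(T)$ be the set of all pairs $(T',\sigma')$ where $T'$ is a subtree of $T$ rooted at some vertex $r$ of $T'$ and $\sigma'$ is the orientation of $T'$ with all edges directed away from $r$. The oriented discrepancy of $T$ is $$\vec{\mathcal{D}}(T)=\min_{\sigma\text{ orientation of }T}\ \max_{(T',\sigma')\in\mathcal O(T)}\ \Big|\sum_{e\in T'} d_{T,T'}^{\sigma,\sigma'}(e)\Big|.$$ -}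

module Defs where

open import Data.Nat using (ℕ; zero; suc; _+_; _*_; _≤_; _≥_) renaming (_≟_ to _≟ℕ_)
open import Data.Integer as ℤ using (ℤ; ∣_∣) renaming (_+_ to _+ℤ_)
open import Data.Fin using (Fin; _≟_)
open import Relation.Nullary using (does)
open import Data.Bool using (Bool; true; false; if_then_else_) renaming (_≟_ to _≟B_)
open import Data.Product using (Σ; _×_; _,_; proj₁; proj₂)
open import Data.Sum using (_⊎_)
open import Data.List using (List; tabulate; foldr)
open import Data.Nat.ListAction using (sum)
open import Relation.Binary.PropositionalEquality using (_≡_)
open import Relation.Binary.Construct.Closure.ReflexiveTransitive using (Star)

-- A (multi)graph on vertex set Fin n with edges indexed by Fin m;
-- `ends e = (u , v)` lists the two endpoints of edge e.
-- Edge subsets are given by their characteristic function Fin m → Bool.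

module _ {n m : ℕ} (ends : Fin m → Fin n × Fin n) where

  Incident : (Fin m → Bool) → Fin n → Set
  Incident S x = Σ (Fin m) λ e → S e ≡ true × (proj₁ (ends e) ≡ x ⊎ proj₂ (ends e) ≡ x)

  Adj : (Fin m → Bool) → Fin n → Fin n → Set
  Adj S x y = Σ (Fin m) λ e → S e ≡ true × (ends e ≡ (x , y) ⊎ ends e ≡ (y , x))

  -- An orientation is a function τ : Fin m → Bool;
  -- τ e = true means e is directed proj₁ (ends e) → proj₂ (ends e),
  -- τ e = false means it is directed proj₂ (ends e) → proj₁ (ends e).
  tail head : (Fin m → Bool) → Fin m → Fin n
  tail τ e = if τ e then proj₁ (ends e) else proj₂ (ends e)
  head τ e = if τ e then proj₂ (ends e) else proj₁ (ends e)

  DAdj : (Fin m → Bool) → (Fin m → Bool) → Fin n → Fin n → Set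
  DAdj S τ x y = Σ (Fin m) λ e → S e ≡ true × (tail τ e ≡ x × head τ e ≡ y)

  ConnectedEdgeSet : (Fin m → Bool) → Set
  ConnectedEdgeSet S = ∀ x y → Incident S x → Incident S y → Star (Adj S) x y

  -- (S , τ) is the subtree S rooted at r (a vertex of S) with all edges directed
  -- away from r: every vertex of S is reached from r by a directed walk in S.
  RootedAway : (Fin m → Bool) → Fin n → (Fin m → Bool) → Set
  RootedAway S r τ = Incident S r × (∀ x → Incident S x → Star (DAdj S τ) r x)

  degree : Fin n → ℕ
  degree x = sum (tabulate {n = m} λ e →
               (if does (x ≟ proj₁ (ends e)) then 1 else 0)
             + (if does (x ≟ proj₂ (ends e)) then 1 else 0))

  leaves : ℕ
  leaves = sum (tabulate {n = n} λ x → if does (degree x ≟ℕ 1) then 1 else 0)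

  orientedSum : (Fin m → Bool) → (Fin m → Bool) → (Fin m → Bool) → ℤ
  orientedSum σ S τ = foldr _+ℤ_ (ℤ.+ 0) (tabulate {n = m} λ e →
      if S e then (if does (σ e ≟B τ e) then ℤ.+ 1 else ℤ.- (ℤ.+ 1)) else ℤ.+ 0)

-- A tree: a connected graph on n vertices with exactly n - 1 edges
-- (equivalently: connected and acyclic).
record Tree : Set where
  field
    n m  : ℕ
    ends : Fin m → Fin n × Fin n
    edgeCount : suc m ≡ n
    connected : ∀ x y → Star (Adj ends (λ _ → true)) x y

open Tree public

numLeaves : Tree → ℕ
numLeaves T = leaves (ends T)

-- Upper bound  b · 𝒟⃗(T) ≤ a : some orientation σ of T has
-- b · |Σ_{e∈T'} d(e)| ≤ a for every (T',σ') ∈ 𝒪(T).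
OrDiscAtMost : Tree → ℕ → ℕ → Set
OrDiscAtMost T a b =
  Σ (Fin (m T) → Bool) λ σ →
    ∀ (S : Fin (m T) → Bool) (r : Fin (n T)) (τ : Fin (m T) → Bool) →
      ConnectedEdgeSet (ends T) S → RootedAway (ends T) S r τ →
      b * ∣ orientedSum (ends T) σ S τ ∣ ≤ a

-- Lower bound  a ≤ b · 𝒟⃗(T) : every orientation σ of T admits (T',σ') ∈ 𝒪(T)
-- with a ≤ b · |Σ_{e∈T'} d(e)|.
OrDiscAtLeast : Tree → ℕ → ℕ → Set
OrDiscAtLeast T a b =
  ∀ (σ : Fin (m T) → Bool) →
    Σ (Fin (m T) → Bool) λ S → Σ (Fin (n T)) λ r → Σ (Fin (m T) → Bool) λ τ →
      ConnectedEdgeSet (ends T) S × RootedAway (ends T) S r τ ×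
      a ≤ b * ∣ orientedSum (ends T) σ S τ ∣

{-# OPTIONS --safe #-}

-- Root the tree at a vertex R and give every edge the sign +1 if it is directed
-- away from R and -1 otherwise.
--
-- Lower bound: keep all inner edges and either the positive or the negative leaf
-- edges. The two signed sums of these subtrees rooted at R differ by the number of
-- leaf edges, so one of them is at least half of it in absolute value.
--
-- Upper bound: decompose the tree into heavy paths with respect to the number of
-- leaves below an edge; there is one path per leaf edge. Let the signs alternate
-- along each path, and let half of the top edges be positive. If S is a connected
-- edge set rooted at r, its discrepancy is Σ_S sign − 2 Σ_(S ∩ path from r to R) sign.
-- In both sums a path contributes 0 or the sign of its first edge in the set. At
-- most one path starts in S below its top edge, so the first sum is at most half the
-- number of paths plus O(1). The path from r to R meets O(log ℓ) heavy paths,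
-- because the number of leaves below at least halves at each light edge.

module Submission where

open import Defs
open import Algebra.Bundles using (CommutativeMonoid)
import Algebra.Properties.CommutativeMonoid.Sum as Sum
open import Data.Bool using (Bool; true; false; if_then_else_; not; _∧_; _∨_) renaming (_≟_ to _≟B_)
open import Data.Bool.Properties using (∧-zeroʳ)
open import Data.Fin using (Fin; zero; suc; _≟_; punchOut)
open import Data.Fin.Properties using (suc-injective; any?; injective⇒≤; punchOut-injective)
open import Data.Integer as ℤ using (ℤ; ∣_∣)
import Data.Integer.Properties as ℤₚ
import Data.List as List
open import Data.Maybe using (Maybe; just; nothing; maybe; is-nothing)
open import Data.Maybe.Properties using (just-injective; ≡-dec)
open import Data.Nat using (ℕ; zero; suc; _+_; _*_; _^_; _∸_; _⊔_; _≤_; _≥_; z≤n; s≤s) renaming (_≟_ to _≟ℕ_)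
import Data.Nat.ListAction as ListAction
import Data.Nat.Properties as ℕₚ
open import Data.Nat.Solver using (module +-*-Solver)
open import Data.Product using (Σ; _×_; _,_; proj₁; proj₂)
open import Data.Product.Properties using () renaming (≡-dec to ×-≡-dec)
open import Data.Sum using (_⊎_; inj₁; inj₂; [_,_]′)
open import Data.Vec.Functional using (_∷_)
open import Function using (_∘_)
open import Function.Bundles using (mk⇔)
open import Relation.Binary.Construct.Closure.ReflexiveTransitive using (Star; ε; _◅_; _◅◅_; reverse) renaming (map to mapStar)
open import Relation.Binary.PropositionalEquality using (_≡_; _≢_; refl; sym; trans; cong; cong₂; subst)
open import Relation.Nullary using (Dec; yes; no; does; ¬_; contradiction; _×-dec_; _⊎-dec_)
open import Relation.Nullary.Decidable using (does-⇔; dec-true; dec-false)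

-- Finite sums

selects : ∀ {b} → Maybe (Fin b) → Fin b → Bool
selects p j = does (≡-dec _≟_ p (just j))

module _ {c ℓ} (M : CommutativeMonoid c ℓ) where
  open CommutativeMonoid M renaming (Carrier to C; ε to 0#; sym to ≈sym)
  open Sum M
  open import Relation.Binary.Reasoning.Setoid setoid

  sum-select : ∀ {b} (p : Maybe (Fin b)) (v : Fin b → C) →
    sum (λ j → if selects p j then v j else 0#) ≈ maybe v 0# p
  sum-select {b}     nothing        v = sum-replicate-zero b
  sum-select {suc b} (just zero)    v = begin
    v zero ∙ sum {b} (λ _ → 0#)  ≈⟨ ∙-congˡ (sum-replicate-zero b) ⟩
    v zero ∙ 0#                  ≈⟨ identityʳ _ ⟩
    v zero                       ∎
  sum-select {suc b} (just (suc i)) v = begin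
    0# ∙ sum (λ j → if selects (just i) j then v (suc j) else 0#)  ≈⟨ identityˡ _ ⟩
    sum (λ j → if selects (just i) j then v (suc j) else 0#)       ≈⟨ sum-select (just i) (v ∘ suc) ⟩
    v (suc i)                                                      ∎

  -- Both sides are the sum of `v i j` over all matched pairs. Writing the match as an indicator
  -- allows the order of summation to be exchanged.
  sum-partialBijection : ∀ {a b} (p : Fin a → Maybe (Fin b)) (q : Fin b → Maybe (Fin a)) →
    (∀ {i j} → p i ≡ just j → q j ≡ just i) → (∀ {i j} → q j ≡ just i → p i ≡ just j) →
    (v : Fin a → Fin b → C) →
    sum (λ i → maybe (v i) 0# (p i)) ≈ sum (λ j → maybe (λ i → v i j) 0# (q j))
  sum-partialBijection p q p⇒q q⇒p v = begin
    sum (λ i → maybe (v i) 0# (p i))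
      ≈⟨ sum-cong-≋ (λ i → ≈sym (sum-select (p i) (v i))) ⟩
    sum (λ i → sum (λ j → if selects (p i) j then v i j else 0#))
      ≈⟨ ∑-comm (λ i j → if selects (p i) j then v i j else 0#) ⟩
    sum (λ j → sum (λ i → if selects (p i) j then v i j else 0#))
      ≡⟨ sum-cong-≗ (λ j → sum-cong-≗ (λ i → cong (λ b → if b then v i j else 0#) (same i j))) ⟩
    sum (λ j → sum (λ i → if selects (q j) i then v i j else 0#))
      ≈⟨ sum-cong-≋ (λ j → sum-select (q j) (λ i → v i j)) ⟩
    sum (λ j → maybe (λ i → v i j) 0# (q j)) ∎
    where
    same : ∀ i j → selects (p i) j ≡ selects (q j) i
    same i j = does-⇔ (mk⇔ p⇒q q⇒p) (≡-dec _≟_ (p i) (just j)) (≡-dec _≟_ (q j) (just i))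

module ℕΣ = Sum ℕₚ.+-0-commutativeMonoid
module ℤΣ = Sum ℤₚ.+-0-commutativeMonoid

∑ : ∀ {k} → (Fin k → ℕ) → ℕ
∑ = ℕΣ.sum

∑ℤ : ∀ {k} → (Fin k → ℤ) → ℤ
∑ℤ = ℤΣ.sum

ind : Bool → ℕ
ind b = if b then 1 else 0

ind≤1 : ∀ b → ind b ≤ 1
ind≤1 true  = ℕₚ.≤-refl
ind≤1 false = z≤n

#_ : ∀ {k} → (Fin k → Bool) → ℕ
# P = ∑ (λ i → ind (P i))

sum-tabulate : ∀ {k} (f : Fin k → ℕ) → ListAction.sum (List.tabulate f) ≡ ∑ f
sum-tabulate {zero}  f = refl
sum-tabulate {suc k} f = cong (f zero +_) (sum-tabulate (f ∘ suc))

foldr-tabulate : ∀ {k} (f : Fin k → ℤ) → List.foldr ℤ._+_ (ℤ.+ 0) (List.tabulate f) ≡ ∑ℤ f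
foldr-tabulate {zero}  f = refl
foldr-tabulate {suc k} f = cong (ℤ._+_ (f zero)) (foldr-tabulate (f ∘ suc))

∑-mono : ∀ {k} {f g : Fin k → ℕ} → (∀ i → f i ≤ g i) → ∑ f ≤ ∑ g
∑-mono {zero}  f≤g = z≤n
∑-mono {suc k} f≤g = ℕₚ.+-mono-≤ (f≤g zero) (∑-mono (f≤g ∘ suc))

∑ℤ-mono : ∀ {k} {f g : Fin k → ℤ} → (∀ i → f i ℤ.≤ g i) → ∑ℤ f ℤ.≤ ∑ℤ g
∑ℤ-mono {zero}  f≤g = ℤₚ.≤-refl
∑ℤ-mono {suc k} f≤g = ℤₚ.+-mono-≤ (f≤g zero) (∑ℤ-mono (f≤g ∘ suc))

∑ℤ-pos : ∀ {k} (f : Fin k → ℕ) → ∑ℤ (λ i → ℤ.+ f i) ≡ ℤ.+ ∑ f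
∑ℤ-pos {zero}  f = refl
∑ℤ-pos {suc k} f = trans (cong (ℤ._+_ (ℤ.+ f zero)) (∑ℤ-pos (f ∘ suc))) (sym (ℤₚ.pos-+ (f zero) _))

∑ℤ-neg : ∀ {k} (f : Fin k → ℤ) → ∑ℤ (λ i → ℤ.- f i) ≡ ℤ.- ∑ℤ f
∑ℤ-neg {zero}  f = refl
∑ℤ-neg {suc k} f = trans (cong (ℤ._+_ (ℤ.- f zero)) (∑ℤ-neg (f ∘ suc))) (sym (ℤₚ.neg-distrib-+ (f zero) _))

term≤∑ : ∀ {k} (f : Fin k → ℕ) i → f i ≤ ∑ f
term≤∑ f zero    = ℕₚ.m≤m+n _ _
term≤∑ f (suc i) = ℕₚ.≤-trans (term≤∑ (f ∘ suc) i) (ℕₚ.m≤n+m _ _)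

-- Positive and negative contributions are bounded separately, so the absolute value costs the
-- larger of the two bounds and not their sum. This brings the factor one half into the upper bound.
∣∑ℤ∣-bound : ∀ {k} {f : Fin k → ℤ} {g h : Fin k → ℕ} {N} →
  (∀ i → f i ℤ.≤ ℤ.+ g i) → (∀ i → ℤ.- f i ℤ.≤ ℤ.+ h i) → ∑ g ≤ N → ∑ h ≤ N → ∣ ∑ℤ f ∣ ≤ N
∣∑ℤ∣-bound {f = f} {g} {h} {N} f≤g -f≤h G H = abs (∑ℤ f) upper lower
  where
  upper : ∑ℤ f ℤ.≤ ℤ.+ N
  upper = ℤₚ.≤-trans (∑ℤ-mono f≤g) (subst (ℤ._≤ _) (sym (∑ℤ-pos g)) (ℤ.+≤+ G))
  lower : ℤ.- ∑ℤ f ℤ.≤ ℤ.+ N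
  lower = subst (ℤ._≤ _) (∑ℤ-neg f)
            (ℤₚ.≤-trans (∑ℤ-mono -f≤h) (subst (ℤ._≤ _) (sym (∑ℤ-pos h)) (ℤ.+≤+ H)))
  abs : ∀ z → z ℤ.≤ ℤ.+ N → ℤ.- z ℤ.≤ ℤ.+ N → ∣ z ∣ ≤ N
  abs (ℤ.+ n)      p _ = ℤₚ.drop‿+≤+ p
  abs (ℤ.-[1+ n ]) _ q = ℤₚ.drop‿+≤+ q

#-none : ∀ {k} (P : Fin k → Bool) → (∀ i → P i ≡ false) → # P ≡ 0
#-none {zero}  P none = refl
#-none {suc k} P none rewrite none zero = #-none (P ∘ suc) (none ∘ suc)

#-unique : ∀ {k} (P : Fin k → Bool) → (∀ {i j} → P i ≡ true → P j ≡ true → i ≡ j) → # P ≤ 1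
#-unique {zero}  P uniq = z≤n
#-unique {suc k} P uniq with P zero in P0
... | true  = ℕₚ.≤-reflexive (cong suc (#-none (P ∘ suc) none))
  where
  none : ∀ i → P (suc i) ≡ false
  none i with P (suc i) in Pi
  ... | false = refl
  ... | true with () ← uniq P0 Pi
... | false = #-unique (P ∘ suc) (λ p q → suc-injective (uniq p q))

#-positive : ∀ {k} {P : Fin k → Bool} i → P i ≡ true → 1 ≤ # P
#-positive {P = P} i Pi = subst (λ b → ind b ≤ # P) Pi (term≤∑ (ind ∘ P) i)

Balanced : ∀ {k} → (Fin k → Bool) → Set
Balanced {k} P = Σ (Fin k → Bool) λ c →
  # (λ i → P i ∧ c i) ≤ suc (# (λ i → P i ∧ not (c i))) ×
  # (λ i → P i ∧ not (c i)) ≤ suc (# (λ i → P i ∧ c i))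

-- A new element of `P` joins the class that is not larger; outside `P` the colour is arbitrary.
balanced-∷ : ∀ {k} b {P : Fin k → Bool} → Balanced P → Balanced (b ∷ P)
balanced-∷ false     (c , +≤ , -≤) = true ∷ c , +≤ , -≤
balanced-∷ true  {P} (c , +≤ , -≤)
  with ℕₚ.≤-total (# (λ i → P i ∧ c i)) (# (λ i → P i ∧ not (c i)))
... | inj₁ le = true ∷ c , s≤s le , ℕₚ.m≤n⇒m≤1+n -≤
... | inj₂ ge = false ∷ c , ℕₚ.m≤n⇒m≤1+n +≤ , s≤s ge

balanced : ∀ {k} (P : Fin k → Bool) → Balanced P
balanced {zero}  P = (λ ()) , z≤n , z≤n
balanced {suc k} P = balanced-∷ (P zero) (balanced (P ∘ suc))

argmax : ∀ {k} {P : Fin k → Set} → (∀ i → Dec (P i)) → (w : Fin k → ℕ) →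
  (∀ i → ¬ P i) ⊎ Σ (Fin k) λ i → P i × (∀ j → P j → w j ≤ w i)
argmax {zero}  P? w = inj₁ λ ()
argmax {suc k} P? w with P? zero | argmax (P? ∘ suc) (w ∘ suc)
... | no ¬p | inj₁ none = inj₁ λ { zero → ¬p ; (suc i) → none i }
... | no ¬p | inj₂ (i , Pi , max) = inj₂ (suc i , Pi , λ { zero p → contradiction p ¬p ; (suc j) → max j })
... | yes p | inj₁ none = inj₂ (zero , p , λ { zero _ → ℕₚ.≤-refl ; (suc j) q → contradiction q (none j) })
... | yes p | inj₂ (i , Pi , max) with ℕₚ.≤-total (w zero) (w (suc i))
...   | inj₁ le = inj₂ (suc i , Pi , λ { zero _ → le ; (suc j) → max j })
...   | inj₂ ge = inj₂ (zero , p , λ { zero _ → ℕₚ.≤-refl ; (suc j) q → ℕₚ.≤-trans (max j q) ge })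

-- Rooting a tree by the distance from a vertex

-- If `y` were missed, punching it out would give an injection into a smaller finite set.
injective⇒hit : ∀ {k} (f : Fin k → Fin k) → (∀ {i j} → f i ≡ f j → i ≡ j) → ∀ y → Σ (Fin k) λ i → f i ≡ y
injective⇒hit {suc k} f inj y with any? (λ i → f i ≟ y)
... | yes hit  = hit
... | no  miss = contradiction
  (injective⇒≤ {f = λ i → punchOut (y≢f i)} (λ eq → inj (punchOut-injective (y≢f _) (y≢f _) eq)))
  ℕₚ.1+n≰n
  where
  y≢f : ∀ i → y ≢ f i
  y≢f i y≡fi = miss (i , sym y≡fi)

least : ∀ {P : ℕ → Set} → (∀ k → Dec (P k)) → ∀ k → P k → Σ ℕ λ j → P j × (∀ i → P i → j ≤ i)
least P? zero    p = 0 , p , λ _ _ → z≤n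
least P? (suc k) p with P? 0
... | yes p₀ = 0 , p₀ , λ _ _ → z≤n
... | no ¬p₀ with least (P? ∘ suc) k p
...   | j , Pj , min = suc j , Pj , λ { zero p₀ → contradiction p₀ ¬p₀ ; (suc i) q → s≤s (min i q) }

-- Each edge is identified with its lower endpoint: `child` and `parentEdge` match the edges with
-- the vertices other than the root. `depth` is the measure for recursion towards the root.
record Rooted {n m : ℕ} (ends : Fin m → Fin n × Fin n) : Set where
  field
    root      : Fin n
    child par : Fin m → Fin n
    -- The orientation value that directs e away from the root.
    down      : Fin m → Bool
    ends≡     : ∀ e → ends e ≡ (if down e then (par e , child e) else (child e , par e))
    depth     : Fin n → ℕ
    depth-root  : depth root ≡ 0
    depth-child : ∀ e → depth (child e) ≡ suc (depth (par e))
    parentEdge  : Fin n → Maybe (Fin m)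
    parentEdge-child   : ∀ e → parentEdge (child e) ≡ just e
    parentEdge-just    : ∀ {x e} → parentEdge x ≡ just e → child e ≡ x
    parentEdge-nothing : ∀ {x} → parentEdge x ≡ nothing → x ≡ root

module BFS {m : ℕ} (ends : Fin m → Fin (suc m) × Fin (suc m))
           (connected : ∀ x y → Star (Adj ends (λ _ → true)) x y) where

  Link : Fin (suc m) → Fin (suc m) → Set
  Link = Adj ends (λ _ → true)

  link? : ∀ x y → Dec (Link x y)
  link? x y = any? λ e → yes refl ×-dec
    (×-≡-dec _≟_ _≟_ (ends e) (x , y) ⊎-dec ×-≡-dec _≟_ _≟_ (ends e) (y , x))

  -- Walks to `zero` of length exactly `k`: a finite search decides whether one exists, so a
  -- shortest length can be found.
  Reach : ℕ → Fin (suc m) → Set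
  Reach zero    x = x ≡ zero
  Reach (suc k) x = Σ (Fin (suc m)) λ y → Reach k y × Link x y

  reach? : ∀ k x → Dec (Reach k x)
  reach? zero    x = x ≟ zero
  reach? (suc k) x = any? λ y → reach? k y ×-dec link? x y

  reach : ∀ {x} → Star Link x zero → Σ ℕ λ k → Reach k x
  reach ε = 0 , refl
  reach (l ◅ walk) with reach walk
  ... | k , r = suc k , _ , r , l

  shortest : ∀ x → Σ ℕ λ j → Reach j x × (∀ i → Reach i x → j ≤ i)
  shortest x with reach (connected x zero)
  ... | k , r = least (λ i → reach? i x) k r

  dist : Fin (suc m) → ℕ
  dist x = proj₁ (shortest x)

  -- The vertex `y` is the second one of a shortest walk. Its distance is at most `j`, and a smaller
  -- one would shorten the walk from `suc i`.
  closer : ∀ i → Σ (Fin (suc m)) λ y → Link (suc i) y × dist (suc i) ≡ suc (dist y)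
  closer i with shortest (suc i)
  ... | suc j , (y , r , l) , min = y , l , cong suc (ℕₚ.≤-antisym
          (ℕₚ.≤-pred (min _ (y , proj₁ (proj₂ (shortest y)) , l)))
          (proj₂ (proj₂ (shortest y)) j r))

  up : Fin m → Fin (suc m)
  up i = proj₁ (closer i)

  edge : Fin m → Fin m
  edge i = proj₁ (proj₁ (proj₂ (closer i)))

  edge-ends : ∀ i → ends (edge i) ≡ (suc i , up i) ⊎ ends (edge i) ≡ (up i , suc i)
  edge-ends i = proj₂ (proj₂ (proj₁ (proj₂ (closer i))))

  dist-suc : ∀ i → dist (suc i) ≡ suc (dist (up i))
  dist-suc i = proj₂ (proj₂ (closer i))

  -- Absurd: each of suc i and suc j would be further from zero than the other.
  crossed : ∀ {i j} → up i ≡ suc j → up j ≡ suc i → i ≡ j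
  crossed {i} {j} p q = contradiction
    (trans (trans (dist-suc i) (cong (λ x → suc (dist x)) p))
      (trans (cong suc (dist-suc j)) (cong (λ x → 2 + dist x) q)))
    (ℕₚ.<⇒≢ (s≤s (ℕₚ.n≤1+n _)))

  edge-injective : ∀ {i j} → edge i ≡ edge j → i ≡ j
  edge-injective {i} {j} eq with edge-ends i | edge-ends j
  ... | inj₁ p | inj₁ q = suc-injective (cong proj₁ (trans (sym p) (trans (cong ends eq) q)))
  ... | inj₂ p | inj₂ q = suc-injective (cong proj₂ (trans (sym p) (trans (cong ends eq) q)))
  ... | inj₁ p | inj₂ q = crossed (cong proj₂ pq) (sym (cong proj₁ pq))
    where pq = trans (sym p) (trans (cong ends eq) q)
  ... | inj₂ p | inj₁ q = crossed (cong proj₁ pq) (sym (cong proj₂ pq))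
    where pq = trans (sym p) (trans (cong ends eq) q)

  -- The m vertices other than zero have distinct parent edges, so each of the m edges is one.
  lower : Fin m → Fin m
  lower e = proj₁ (injective⇒hit edge edge-injective e)

  edge-lower : ∀ e → edge (lower e) ≡ e
  edge-lower e = proj₂ (injective⇒hit edge edge-injective e)

  oriented : ∀ e → Σ Bool λ b →
    ends e ≡ (if b then (up (lower e) , suc (lower e)) else (suc (lower e) , up (lower e)))
  oriented e with edge-ends (lower e)
  ... | inj₁ p = false , trans (cong ends (sym (edge-lower e))) p
  ... | inj₂ p = true  , trans (cong ends (sym (edge-lower e))) p

  upEdge : Fin (suc m) → Maybe (Fin m)
  upEdge zero    = nothing
  upEdge (suc i) = just (edge i)

  upEdge-just : ∀ {x e} → upEdge x ≡ just e → suc (lower e) ≡ x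
  upEdge-just {suc i} refl = cong suc (edge-injective (edge-lower (edge i)))

  upEdge-nothing : ∀ {x} → upEdge x ≡ nothing → x ≡ zero
  upEdge-nothing {zero} _ = refl

  rooted : Rooted ends
  rooted = record
    { root        = zero
    ; child       = suc ∘ lower
    ; par         = up ∘ lower
    ; down        = proj₁ ∘ oriented
    ; ends≡       = proj₂ ∘ oriented
    ; depth       = dist
    ; depth-root  = ℕₚ.n≤0⇒n≡0 (proj₂ (proj₂ (shortest zero)) 0 refl)
    ; depth-child = dist-suc ∘ lower
    ; parentEdge  = upEdge
    ; parentEdge-child   = cong just ∘ edge-lower
    ; parentEdge-just    = upEdge-just
    ; parentEdge-nothing = upEdge-nothing
    }

rooted : (T : Tree) → Rooted (ends T)
rooted record { ends = ends ; edgeCount = refl ; connected = connected } = BFS.rooted ends connected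

-- The ancestor order of a rooted tree

module RootedTree {n m : ℕ} {ends : Fin m → Fin n × Fin n} (Rt : Rooted ends) where
  open Rooted Rt

  child-injective : ∀ {e f} → child e ≡ child f → e ≡ f
  child-injective {e} {f} eq = just-injective
    (trans (sym (parentEdge-child e)) (trans (cong parentEdge eq) (parentEdge-child f)))

  child≢root : ∀ e → child e ≢ root
  child≢root e eq with () ← trans (sym depth-root) (trans (cong depth (sym eq)) (depth-child e))

  vertex-ind : (P : Fin n → Set) → P root → (∀ e → P (par e) → P (child e)) → ∀ x → P x
  vertex-ind P P-root P-child x = go (depth x) x refl
    where
    go : ∀ k x → depth x ≡ k → P x
    go k x eq with parentEdge x in up
    ... | nothing = subst P (sym (parentEdge-nothing up)) P-root
    ... | just e with refl ← parentEdge-just up with k | trans (sym eq) (depth-child e)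
    ...   | suc k | eq = P-child e (go k (par e) (sym (ℕₚ.suc-injective eq)))

  rootOrChild : ∀ x → x ≡ root ⊎ Σ (Fin m) λ e → child e ≡ x
  rootOrChild x with parentEdge x in up
  ... | nothing = inj₁ (parentEdge-nothing up)
  ... | just e  = inj₂ (e , parentEdge-just up)

  infix 4 _⊑_

  -- The ancestor order: `child f ⊑ x` says that `f` lies on the path from `x` to the root.
  data _⊑_ (v : Fin n) : Fin n → Set where
    here  : v ⊑ v
    under : ∀ e → v ⊑ par e → v ⊑ child e

  ⊑-child⁻¹ : ∀ {v x} → v ⊑ x → ∀ e → child e ≡ x → v ≡ x ⊎ v ⊑ par e
  ⊑-child⁻¹ here        e eq = inj₁ refl
  ⊑-child⁻¹ (under f p) e eq with refl ← child-injective eq = inj₂ p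

  ⊑-root⁻¹ : ∀ {v x} → v ⊑ x → x ≡ root → v ≡ root
  ⊑-root⁻¹ here        eq = eq
  ⊑-root⁻¹ (under e p) eq = contradiction eq (child≢root e)

  par⊑child : ∀ e → par e ⊑ child e
  par⊑child e = under e here

  ⊑-trans : ∀ {u v w} → u ⊑ v → v ⊑ w → u ⊑ w
  ⊑-trans p here        = p
  ⊑-trans p (under e q) = under e (⊑-trans p q)

  ⊑⇒depth≤ : ∀ {v x} → v ⊑ x → depth v ≤ depth x
  ⊑⇒depth≤ here        = ℕₚ.≤-refl
  ⊑⇒depth≤ (under e p) rewrite depth-child e = ℕₚ.m≤n⇒m≤1+n (⊑⇒depth≤ p)

  child⋢par : ∀ e → ¬ child e ⊑ par e
  child⋢par e p = ℕₚ.<⇒≱ (ℕₚ.≤-reflexive (sym (depth-child e))) (⊑⇒depth≤ p)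

  ⊑-antisym : ∀ {v w} → v ⊑ w → w ⊑ v → v ≡ w
  ⊑-antisym here        q = refl
  ⊑-antisym (under e p) q = contradiction (⊑-trans q p) (child⋢par e)

  -- Later proofs use only the outcome of this decision, so its computation is kept opaque.
  abstract
    _⊑?_ : ∀ v x → Dec (v ⊑ x)
    v ⊑? x = vertex-ind (λ x → Dec (v ⊑ x)) at-root at-child x
      where
      at-root : Dec (v ⊑ root)
      at-root with v ≟ root
      ... | yes refl = yes here
      ... | no v≢    = no λ p → v≢ (⊑-root⁻¹ p refl)
      at-child : ∀ e → Dec (v ⊑ par e) → Dec (v ⊑ child e)
      at-child e (yes p) = yes (under e p)
      at-child e (no ¬p) with v ≟ child e
      ... | yes refl = yes here
      ... | no v≢    = no λ q → [ v≢ , ¬p ]′ (⊑-child⁻¹ q e refl)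

  ⊑-chain : ∀ {v w x} → v ⊑ x → w ⊑ x → v ⊑ w ⊎ w ⊑ v
  ⊑-chain here        q = inj₂ q
  ⊑-chain (under e p) q with ⊑-child⁻¹ q e refl
  ... | inj₁ refl = inj₁ (under e p)
  ... | inj₂ q′   = ⊑-chain p q′

  -- Two ancestors of `x` are comparable. If they were distinct, the lower end of one edge would be
  -- an ancestor of its own upper end.
  siblings-disjoint : ∀ {e f x} → par e ≡ par f → child e ⊑ x → child f ⊑ x → e ≡ f
  siblings-disjoint {e} {f} eq p q with ⊑-chain p q
  ... | inj₁ e⊑f with ⊑-child⁻¹ e⊑f f refl
  ...   | inj₁ same = child-injective same
  ...   | inj₂ e⊑   = contradiction (subst (child e ⊑_) (sym eq) e⊑) (child⋢par e)
  siblings-disjoint {e} {f} eq p q | inj₂ f⊑e with ⊑-child⁻¹ f⊑e e refl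
  ...   | inj₁ same = sym (child-injective same)
  ...   | inj₂ f⊑   = contradiction (subst (child f ⊑_) eq f⊑) (child⋢par f)

  -- The vertices other than the root are the lower endpoints of the edges, which turns counts of
  -- vertices into counts of edges.
  ∑-vertices : (f : Fin n → ℕ) → ∑ f ≡ f root + ∑ (f ∘ child)
  ∑-vertices f = trans (ℕΣ.sum-cong-≗ split) (trans (ℕΣ.∑-distrib-+ atRoot atChild)
    (cong₂ _+_ (sum-select ℕₚ.+-0-commutativeMonoid (just root) f)
               (sum-partialBijection ℕₚ.+-0-commutativeMonoid parentEdge (just ∘ child)
                 (cong just ∘ parentEdge-just) (λ { refl → parentEdge-child _ }) (λ x _ → f x))))
    where
    atRoot atChild : Fin n → ℕ
    atRoot x = if selects (just root) x then f x else 0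
    atChild x = maybe (λ _ → f x) 0 (parentEdge x)
    split : ∀ x → f x ≡ atRoot x + atChild x
    split x with parentEdge x in up
    ... | nothing rewrite dec-true (root ≟ x) (sym (parentEdge-nothing up)) = sym (ℕₚ.+-identityʳ _)
    ... | just e  rewrite dec-false (root ≟ x) (λ eq → child≢root e (trans (parentEdge-just up) (sym eq))) = refl

  -- Leaves and leaf edges

  HasChild : Fin n → Set
  HasChild x = Σ (Fin m) λ e → par e ≡ x

  hasChild? : ∀ x → Dec (HasChild x)
  hasChild? x = any? λ e → par e ≟ x

  -- Only lower endpoints are examined, so the number of leaf edges is one less than `leaves` if the
  -- root itself has degree one.
  isLeaf : Fin m → Bool
  isLeaf e = not (does (hasChild? (child e)))

  -- Among the edges at `child f`, only `f` has it as lower endpoint; all others have it as upper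
  -- endpoint.
  degree-child : ∀ f → degree ends (child f) ≡ suc (# λ e → does (child f ≟ par e))
  degree-child f = trans (sum-tabulate {m} _) (trans (ℕΣ.sum-cong-≗ reorder)
    (trans (ℕΣ.∑-distrib-+ (λ e → ind (does (f ≟ e))) (λ e → ind (does (child f ≟ par e))))
      (cong (_+ (# λ e → does (child f ≟ par e))) (sum-select ℕₚ.+-0-commutativeMonoid (just f) (λ _ → 1)))))
    where
    reorder : ∀ e → ind (does (child f ≟ proj₁ (ends e))) + ind (does (child f ≟ proj₂ (ends e)))
                  ≡ ind (does (f ≟ e)) + ind (does (child f ≟ par e))
    reorder e rewrite does-⇔ (mk⇔ (cong child) child-injective) (f ≟ e) (child f ≟ child e) | ends≡ e with down e
    ... | true  = ℕₚ.+-comm (ind (does (child f ≟ par e))) _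
    ... | false = refl

  degree-1⇔isLeaf : ∀ f → does (degree ends (child f) ≟ℕ 1) ≡ isLeaf f
  degree-1⇔isLeaf f rewrite degree-child f with hasChild? (child f)
  ... | yes (e , eq) = dec-false (suc _ ≟ℕ 1) λ one → ℕₚ.<⇒≢
          (#-positive {P = λ e → does (child f ≟ par e)} e (dec-true (child f ≟ par e) (sym eq))) (sym (ℕₚ.suc-injective one))
  ... | no none      = dec-true (suc _ ≟ℕ 1) (cong suc
          (#-none (λ e → does (child f ≟ par e)) λ e → dec-false (child f ≟ par e) λ eq → none (e , sym eq)))

  leaves≡ : leaves ends ≡ ind (does (degree ends root ≟ℕ 1)) + # isLeaf
  leaves≡ = trans (sum-tabulate {n} _) (trans (∑-vertices _)
    (cong (ind (does (degree ends root ≟ℕ 1)) +_) (ℕΣ.sum-cong-≗ λ e → cong ind (degree-1⇔isLeaf e))))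

  #isLeaf≤leaves : # isLeaf ≤ leaves ends
  #isLeaf≤leaves rewrite leaves≡ = ℕₚ.m≤n+m _ _

  leaves≤1+#isLeaf : leaves ends ≤ suc (# isLeaf)
  leaves≤1+#isLeaf rewrite leaves≡ with does (degree ends root ≟ℕ 1)
  ... | true  = ℕₚ.≤-refl
  ... | false = ℕₚ.n≤1+n _

  2≤leaves⇒1≤#isLeaf : 2 ≤ leaves ends → 1 ≤ # isLeaf
  2≤leaves⇒1≤#isLeaf 2≤ℓ = ℕₚ.≤-pred (ℕₚ.≤-trans 2≤ℓ leaves≤1+#isLeaf)

  -- Incidence and subtrees containing the root

  Incident⁻¹ : ∀ {S x} → Incident ends S x → Σ (Fin m) λ e → S e ≡ true × (child e ≡ x ⊎ par e ≡ x)
  Incident⁻¹ (e , Se , inc) = e , Se , endpoint inc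
    where
    endpoint : ∀ {x} → proj₁ (ends e) ≡ x ⊎ proj₂ (ends e) ≡ x → child e ≡ x ⊎ par e ≡ x
    endpoint inc rewrite ends≡ e with down e | inc
    ... | true  | inj₁ p = inj₂ p
    ... | true  | inj₂ p = inj₁ p
    ... | false | inj₁ p = inj₁ p
    ... | false | inj₂ p = inj₂ p

  incident-child : ∀ {S} e → S e ≡ true → Incident ends S (child e)
  incident-child e Se = e , Se , endpoint
    where
    endpoint : proj₁ (ends e) ≡ child e ⊎ proj₂ (ends e) ≡ child e
    endpoint rewrite ends≡ e with down e
    ... | true  = inj₂ refl
    ... | false = inj₁ refl

  incident-par : ∀ {S} e → S e ≡ true → Incident ends S (par e)
  incident-par e Se = e , Se , endpoint
    where
    endpoint : proj₁ (ends e) ≡ par e ⊎ proj₂ (ends e) ≡ par e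
    endpoint rewrite ends≡ e with down e
    ... | true  = inj₁ refl
    ... | false = inj₂ refl

  DAdj⇒Adj : ∀ {S τ x y} → DAdj ends S τ x y → Adj ends S x y
  DAdj⇒Adj {τ = τ} (e , Se , refl , refl) with τ e
  ... | true  = e , Se , inj₁ refl
  ... | false = e , Se , inj₂ refl

  Adj-sym : ∀ {S x y} → Adj ends S x y → Adj ends S y x
  Adj-sym (e , Se , inj₁ p) = e , Se , inj₂ p
  Adj-sym (e , Se , inj₂ p) = e , Se , inj₁ p

  leaving⇒incident : ∀ {S τ x y} → Star (DAdj ends S τ) x y → x ≢ y → Incident ends S x
  leaving⇒incident ε x≢y = contradiction refl x≢y
  leaving⇒incident {τ = τ} ((e , Se , refl , refl) ◅ _) _ with τ e
  ... | true  = e , Se , inj₁ refl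
  ... | false = e , Se , inj₂ refl

  step-down : ∀ {S} e → S e ≡ true → DAdj ends S down (par e) (child e)
  step-down e Se = e , Se , endpoints
    where
    endpoints : tail ends down e ≡ par e × head ends down e ≡ child e
    endpoints rewrite ends≡ e with down e
    ... | true  = refl , refl
    ... | false = refl , refl

  module UpClosed {S : Fin m → Bool}
      (upClosed : ∀ {e f} → S e ≡ true → child f ≡ par e → S f ≡ true) where

    -- The condition on `x` is vacuous at the root and elsewhere says that the parent edge of `x` is
    -- in `S`. Upward closure passes it on to the parent vertex.
    fromRoot : ∀ x → (∀ f → child f ≡ x → S f ≡ true) → Star (DAdj ends S down) root x
    fromRoot = vertex-ind (λ x → (∀ f → child f ≡ x → S f ≡ true) → Star (DAdj ends S down) root x)
      (λ _ → ε)
      (λ e walk Sup → walk (λ f → upClosed (Sup e refl)) ◅◅ (step-down e (Sup e refl) ◅ ε))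

    reachable : ∀ x → Incident ends S x → Star (DAdj ends S down) root x
    reachable x inc with Incident⁻¹ inc
    ... | e , Se , inj₁ refl = fromRoot x λ f eq → subst (λ g → S g ≡ true) (sym (child-injective eq)) Se
    ... | e , Se , inj₂ refl = fromRoot x λ f → upClosed Se

    upClosed⇒connected : ConnectedEdgeSet ends S
    upClosed⇒connected x y incx incy =
      reverse Adj-sym (mapStar DAdj⇒Adj (reachable x incx)) ◅◅ mapStar DAdj⇒Adj (reachable y incy)

    upClosed⇒rootedAway : ∀ e → S e ≡ true → RootedAway ends S root down
    upClosed⇒rootedAway e Se =
      -- A walk in `S` from the root to `child e` is not empty, so its first edge shows that the
      -- root is a vertex of `S`.
      leaving⇒incident (reachable (child e) (incident-child e Se)) (child≢root e ∘ sym) , reachable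

-- Arithmetic of the bounds

2*⊔≤ : ∀ {a b} → a ≤ suc b → b ≤ suc a → 2 * (a ⊔ b) ≤ suc (a + b)
2*⊔≤ {a} {b} a≤ b≤ with ℕₚ.≤-total a b
... | inj₁ a≤b rewrite ℕₚ.m≤n⇒m⊔n≡n a≤b | ℕₚ.+-identityʳ b = ℕₚ.+-monoˡ-≤ b b≤
... | inj₂ b≤a rewrite ℕₚ.m≥n⇒m⊔n≡m b≤a | ℕₚ.+-identityʳ a =
  ℕₚ.≤-trans (ℕₚ.+-monoʳ-≤ a a≤) (ℕₚ.≤-reflexive (ℕₚ.+-suc a b))

-- Here `w` and `p` stand for the absolute sums over the subtree and over its part on the path to
-- the root. Each `+ 1` pays for one segment that starts below a top; the constant 7 is
-- `2 * (1 + 2)` for these, plus 1 from the balancing.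
error-arithmetic : ∀ N t {l w p D} → 2 * N ≤ suc l → w ≤ N + 1 → p ≤ t + 1 → D ≤ w + (p + p) →
  2 * D ≤ l + (4 * t + 7)
error-arithmetic N t {l} {w} {p} {D} N≤ w≤ p≤ D≤ = begin
  2 * D                                ≤⟨ ℕₚ.*-monoʳ-≤ 2 (ℕₚ.≤-trans D≤ (ℕₚ.+-mono-≤ w≤ (ℕₚ.+-mono-≤ p≤ p≤))) ⟩
  2 * ((N + 1) + ((t + 1) + (t + 1)))
    ≡⟨ solve 2 (λ N t → con 2 :* ((N :+ con 1) :+ ((t :+ con 1) :+ (t :+ con 1)))
                     := con 2 :* N :+ (con 4 :* t :+ con 6)) refl N t ⟩
  2 * N + (4 * t + 6)                  ≤⟨ ℕₚ.+-monoˡ-≤ (4 * t + 6) N≤ ⟩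
  suc l + (4 * t + 6)
    ≡⟨ solve 2 (λ l t → con 1 :+ l :+ (con 4 :* t :+ con 6) := l :+ (con 4 :* t :+ con 7)) refl l t ⟩
  l + (4 * t + 7)                      ∎
  where
  open ℕₚ.≤-Reasoning
  open +-*-Solver

-- The right side doubles at each step, and `(u + 1)² ≤ 2u²` holds from `u = 3` on; hence the three
-- base cases.
[1+t]²≤4*2^t : ∀ t → suc t * suc t ≤ 4 * 2 ^ t
[1+t]²≤4*2^t 0 = s≤s z≤n
[1+t]²≤4*2^t 1 = s≤s (s≤s (s≤s (s≤s z≤n)))
[1+t]²≤4*2^t 2 = ℕₚ.m≤m+n 9 7
[1+t]²≤4*2^t (suc (suc (suc t))) = begin
  (4 + t) * (4 + t)                                ≤⟨ ℕₚ.m≤m+n _ (t * t + 4 * t + 2) ⟩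
  (4 + t) * (4 + t) + (t * t + 4 * t + 2)
    ≡⟨ solve 1 (λ t → (con 4 :+ t) :* (con 4 :+ t) :+ (t :* t :+ con 4 :* t :+ con 2)
                   := con 2 :* ((con 3 :+ t) :* (con 3 :+ t))) refl t ⟩
  2 * ((3 + t) * (3 + t))                          ≤⟨ ℕₚ.*-monoʳ-≤ 2 ([1+t]²≤4*2^t (suc (suc t))) ⟩
  2 * (4 * 2 ^ (2 + t))                            ≡⟨ solve 1 (λ p → con 2 :* (con 4 :* p) := con 4 :* (con 2 :* p)) refl (2 ^ (2 + t)) ⟩
  4 * 2 ^ (3 + t)                                  ∎
  where
  open ℕₚ.≤-Reasoning
  open +-*-Solver

square-cancel-≤ : ∀ {a b} → a * a ≤ b * b → a ≤ b
square-cancel-≤ {a} {b} le with ℕₚ.≤-total a b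
... | inj₁ a≤b = a≤b
... | inj₂ b≤a with ℕₚ.m≤n⇒m<n∨m≡n b≤a
...   | inj₁ b<a  = contradiction le (ℕₚ.<⇒≱ (ℕₚ.*-mono-< b<a b<a))
...   | inj₂ refl = ℕₚ.≤-refl

-- From (1 + t)² ≤ 4 · 2^t ≤ 8ℓ one gets (7K(1 + t))² ≤ 8(7K)²ℓ, which is at most ℓ² above this value.
threshold : ℕ → ℕ
threshold K = 8 * (7 * K * (7 * K))

logarithmic-error : ∀ K {ℓ t} → threshold K ≤ ℓ → 2 ^ t ≤ 2 * ℓ → K * (4 * t + 7) ≤ ℓ
logarithmic-error K {ℓ} {t} large 2^t≤ = ℕₚ.≤-trans linear (square-cancel-≤ (begin
  (x * suc t) * (x * suc t)        ≡⟨ solve 2 (λ x u → (x :* u) :* (x :* u) := (x :* x) :* (u :* u)) refl x (suc t) ⟩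
  (x * x) * (suc t * suc t)        ≤⟨ ℕₚ.*-monoʳ-≤ (x * x) (ℕₚ.≤-trans ([1+t]²≤4*2^t t) (ℕₚ.*-monoʳ-≤ 4 2^t≤)) ⟩
  (x * x) * (4 * (2 * ℓ))          ≡⟨ solve 2 (λ y l → y :* (con 4 :* (con 2 :* l)) := con 8 :* y :* l) refl (x * x) ℓ ⟩
  8 * (x * x) * ℓ                  ≤⟨ ℕₚ.*-monoˡ-≤ ℓ large ⟩
  ℓ * ℓ                            ∎))
  where
  open ℕₚ.≤-Reasoning
  open +-*-Solver
  x = 7 * K
  linear : K * (4 * t + 7) ≤ x * suc t
  linear = begin
    -- Rounding `4t + 7` up to `7(1 + t)` produces the 7 in `threshold`.
    K * (4 * t + 7)            ≤⟨ ℕₚ.*-monoʳ-≤ K (ℕₚ.m≤m+n _ (3 * t)) ⟩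
    K * (4 * t + 7 + 3 * t)    ≡⟨ solve 2 (λ K t → K :* (con 4 :* t :+ con 7 :+ con 3 :* t) := con 7 :* K :* (con 1 :+ t)) refl K t ⟩
    7 * K * suc t              ∎

8*[1+k]≤threshold : ∀ k → 8 * suc k ≤ threshold (suc k)
8*[1+k]≤threshold k = ℕₚ.*-monoʳ-≤ 8 (ℕₚ.≤-trans (ℕₚ.m≤n*m (suc k) 7) (ℕₚ.m≤m*n (7 * suc k) (7 * suc k)))

1+k≤threshold : ∀ k → suc k ≤ threshold (suc k)
1+k≤threshold k = ℕₚ.≤-trans (ℕₚ.m≤n*m (suc k) 8) (8*[1+k]≤threshold k)

2≤threshold : ∀ k → 2 ≤ threshold (suc k)
2≤threshold k = ℕₚ.≤-trans (ℕₚ.*-mono-≤ {2} {8} (s≤s (s≤s z≤n)) (s≤s (z≤n {k}))) (8*[1+k]≤threshold k)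

-- A root that is a leaf costs at most `k + 1` after scaling, and one of the `k + 1` copies of `ℓ`
-- is given up to pay for it.
lower-arithmetic : ∀ k {ℓ N D} → suc k ≤ ℓ → ℓ ≤ suc N → N ≤ 2 * D → k * ℓ ≤ 2 * suc k * D
lower-arithmetic k {ℓ} {N} {D} k<ℓ ℓ≤ N≤ = begin
  k * ℓ               ≤⟨ ℕₚ.+-cancelˡ-≤ (suc k) _ _ (ℕₚ.≤-trans (ℕₚ.+-monoˡ-≤ (k * ℓ) k<ℓ)
                           (ℕₚ.≤-trans (ℕₚ.*-monoʳ-≤ (suc k) ℓ≤) (ℕₚ.≤-reflexive (ℕₚ.*-suc (suc k) N)))) ⟩
  suc k * N           ≤⟨ ℕₚ.*-monoʳ-≤ (suc k) N≤ ⟩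
  suc k * (2 * D)     ≡⟨ solve 2 (λ K D → K :* (con 2 :* D) := con 2 :* K :* D) refl (suc k) D ⟩
  2 * suc k * D       ∎
  where
  open ℕₚ.≤-Reasoning
  open +-*-Solver

upper-arithmetic : ∀ k {ℓ N D E} → N ≤ ℓ → 2 * D ≤ N + E → suc k * E ≤ ℓ → 2 * suc k * D ≤ suc (suc k) * ℓ
upper-arithmetic k {ℓ} {N} {D} {E} N≤ D≤ E≤ = begin
  2 * suc k * D              ≡⟨ solve 2 (λ K D → con 2 :* K :* D := K :* (con 2 :* D)) refl (suc k) D ⟩
  suc k * (2 * D)            ≤⟨ ℕₚ.*-monoʳ-≤ (suc k) (ℕₚ.≤-trans D≤ (ℕₚ.+-monoˡ-≤ E N≤)) ⟩
  suc k * (ℓ + E)            ≡⟨ ℕₚ.*-distribˡ-+ (suc k) ℓ E ⟩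
  suc k * ℓ + suc k * E      ≤⟨ ℕₚ.+-monoʳ-≤ (suc k * ℓ) E≤ ⟩
  suc k * ℓ + ℓ              ≡⟨ ℕₚ.+-comm (suc k * ℓ) ℓ ⟩
  suc (suc k) * ℓ            ∎
  where
  open ℕₚ.≤-Reasoning
  open +-*-Solver

sgn : Bool → ℤ
sgn b = if b then ℤ.+ 1 else ℤ.- (ℤ.+ 1)

m≤n+o⇒m≤2n⊎m≤2o : ∀ {m} n o → m ≤ n + o → m ≤ 2 * n ⊎ m ≤ 2 * o
m≤n+o⇒m≤2n⊎m≤2o n o le rewrite ℕₚ.+-identityʳ n | ℕₚ.+-identityʳ o with ℕₚ.≤-total n o
... | inj₁ n≤o = inj₂ (ℕₚ.≤-trans le (ℕₚ.+-monoˡ-≤ o n≤o))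
... | inj₂ o≤n = inj₁ (ℕₚ.≤-trans le (ℕₚ.+-monoʳ-≤ n o≤n))

-- Lower bound

module LowerBound {n m : ℕ} {ends : Fin m → Fin n × Fin n} (Rt : Rooted ends) (σ : Fin m → Bool) where
  open Rooted Rt
  open RootedTree Rt

  pruned : Bool → Fin m → Bool
  pruned b e = not (isLeaf e) ∨ does (does (σ e ≟B down e) ≟B b)

  -- An edge with another edge below it is an inner edge and is always kept.
  pruned-upClosed : ∀ b {e f} → pruned b e ≡ true → child f ≡ par e → pruned b f ≡ true
  pruned-upClosed b {e} {f} _ eq rewrite dec-true (hasChild? (child f)) (e , sym eq) = refl

  prunedSum : Bool → ℤ
  prunedSum b = orientedSum ends σ (pruned b) down

  prunedTerm : Bool → Fin m → ℤ
  prunedTerm b e = if pruned b e then sgn (does (σ e ≟B down e)) else ℤ.+ 0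

  prunedSum≡ : ∀ b → prunedSum b ≡ ∑ℤ (prunedTerm b)
  prunedSum≡ b = foldr-tabulate (prunedTerm b)

  -- Inner edges cancel; a leaf edge contributes either `+1` to the first sum or `-1` to the second.
  difference : prunedSum true ℤ.- prunedSum false ≡ ℤ.+ (# isLeaf)
  difference = trans (cong₂ ℤ._-_ (prunedSum≡ true) (prunedSum≡ false))
    (trans (cong (ℤ._+_ (∑ℤ (prunedTerm true))) (sym (∑ℤ-neg (prunedTerm false))))
    (trans (sym (ℤΣ.∑-distrib-+ (prunedTerm true) (λ e → ℤ.- prunedTerm false e)))
    (trans (ℤΣ.sum-cong-≗ pointwise) (∑ℤ-pos (λ e → ind (isLeaf e))))))
    where
    pointwise : ∀ e → prunedTerm true e ℤ.+ (ℤ.- prunedTerm false e) ≡ ℤ.+ ind (isLeaf e)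
    pointwise e with isLeaf e | does (σ e ≟B down e)
    ... | true  | true  = refl
    ... | true  | false = refl
    ... | false | true  = refl
    ... | false | false = refl

  large : Σ Bool λ b → # isLeaf ≤ 2 * ∣ prunedSum b ∣
  large with m≤n+o⇒m≤2n⊎m≤2o ∣ prunedSum true ∣ ∣ prunedSum false ∣
    (subst (λ k → k ≤ ∣ prunedSum true ∣ + ∣ prunedSum false ∣) (cong ∣_∣ difference)
      (ℤₚ.∣i-j∣≤∣i∣+∣j∣ (prunedSum true) (prunedSum false)))
  ... | inj₁ le = true , le
  ... | inj₂ le = false , le

  -- The root of a subtree must be incident to one of its edges, so an edge is required; without one
  -- the sum would vanish.
  pruned-nonempty : ∀ b → 1 ≤ ∣ prunedSum b ∣ → Σ (Fin m) λ e → pruned b e ≡ true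
  pruned-nonempty b pos with any? (λ e → pruned b e ≟B true)
  ... | yes e = e
  ... | no none = contradiction (cong ∣_∣ (trans (prunedSum≡ b) (trans (ℤΣ.sum-cong-≗ vanish) (ℤΣ.sum-replicate-zero m))))
                    (ℕₚ.<⇒≢ pos ∘ sym)
    where
    vanish : ∀ e → prunedTerm b e ≡ ℤ.+ 0
    vanish e with pruned b e in eq
    ... | true  = contradiction (e , eq) none
    ... | false = refl

  largeSubtree : 1 ≤ # isLeaf → Σ (Fin m → Bool) λ S → Σ (Fin n) λ r → Σ (Fin m → Bool) λ τ →
    ConnectedEdgeSet ends S × RootedAway ends S r τ × # isLeaf ≤ 2 * ∣ orientedSum ends σ S τ ∣
  largeSubtree pos with large
  ... | b , le with pruned-nonempty b (nonzero (ℕₚ.≤-trans pos le))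
    where
    nonzero : ∀ {k} → 1 ≤ 2 * k → 1 ≤ k
    nonzero {suc k} _ = s≤s z≤n
  ...   | e , Se = pruned b , root , down , UpClosed.upClosed⇒connected (λ {e} {f} → pruned-upClosed b {e} {f})
                   , UpClosed.upClosed⇒rootedAway (λ {e} {f} → pruned-upClosed b {e} {f}) e Se , le

  atLeast : ∀ k → threshold (suc k) ≤ leaves ends →
    Σ (Fin m → Bool) λ S → Σ (Fin n) λ r → Σ (Fin m → Bool) λ τ →
      ConnectedEdgeSet ends S × RootedAway ends S r τ ×
      k * leaves ends ≤ 2 * suc k * ∣ orientedSum ends σ S τ ∣
  atLeast k large =
    let S , r , τ , connected , away , le = largeSubtree (2≤leaves⇒1≤#isLeaf (ℕₚ.≤-trans (2≤threshold k) large))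
    in  S , r , τ , connected , away ,
        lower-arithmetic k {leaves ends} {# isLeaf} {∣ orientedSum ends σ S τ ∣}
          (ℕₚ.≤-trans (1+k≤threshold k) large) leaves≤1+#isLeaf le

-- Heavy paths

ind-is-nothing : ∀ {b} (p : Maybe (Fin b)) → ind (is-nothing p) + maybe (λ _ → 1) 0 p ≡ 1
ind-is-nothing nothing  = refl
ind-is-nothing (just _) = refl

module HeavyPaths {n m : ℕ} {ends : Fin m → Fin n × Fin n} (Rt : Rooted ends) where
  open Rooted Rt
  open RootedTree Rt

  weight : Fin m → ℕ
  weight e = # λ f → isLeaf f ∧ does (child e ⊑? child f)

  weight≤#isLeaf : ∀ e → weight e ≤ # isLeaf
  weight≤#isLeaf e = ∑-mono pointwise
    where
    pointwise : ∀ f → ind (isLeaf f ∧ does (child e ⊑? child f)) ≤ ind (isLeaf f)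
    pointwise f with isLeaf f | does (child e ⊑? child f)
    ... | true  | true  = ℕₚ.≤-refl
    ... | true  | false = z≤n
    ... | false | _     = z≤n

  -- The deepest edge below e is a leaf edge.
  weight≥1 : ∀ e → 1 ≤ weight e
  weight≥1 e with argmax (λ f → child e ⊑? child f) (depth ∘ child)
  ... | inj₁ none = contradiction here (none e)
  ... | inj₂ (f , e⊑f , deepest) = #-positive f leaf
    where
    childless : ¬ HasChild (child f)
    childless (g , eq) = ℕₚ.<⇒≱ (ℕₚ.≤-reflexive (sym (trans (depth-child g) (cong (λ x → suc (depth x)) eq))))
      (deepest g (⊑-trans e⊑f (subst (_⊑ child g) eq (par⊑child g))))
    leaf : isLeaf f ∧ does (child e ⊑? child f) ≡ true
    leaf rewrite dec-false (hasChild? (child f)) childless | dec-true (child e ⊑? child f) e⊑f = refl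

  weight-mono : ∀ {e f} → par f ≡ child e → weight f ≤ weight e
  weight-mono {e} {f} eq = ∑-mono pointwise
    where
    pointwise : ∀ g → ind (isLeaf g ∧ does (child f ⊑? child g)) ≤ ind (isLeaf g ∧ does (child e ⊑? child g))
    pointwise g with isLeaf g | child f ⊑? child g | child e ⊑? child g
    ... | false | _     | _     = z≤n
    ... | true  | no _  | _     = z≤n
    ... | true  | yes _ | yes _ = ℕₚ.≤-refl
    ... | true  | yes p | no ¬q = contradiction (⊑-trans (subst (_⊑ child f) eq (par⊑child f)) p) ¬q

  -- The leaf edges below `f` and those below `g` are disjoint, and all of them lie below `e`.
  weight-siblings : ∀ {e f g} → par f ≡ child e → par g ≡ child e → f ≢ g → weight f + weight g ≤ weight e
  weight-siblings {e} {f} {g} eqf eqg f≢g = ℕₚ.≤-trans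
    (ℕₚ.≤-reflexive (sym (ℕΣ.∑-distrib-+ (λ h → ind (isLeaf h ∧ does (child f ⊑? child h))) _)))
    (∑-mono pointwise)
    where
    pointwise : ∀ h → ind (isLeaf h ∧ does (child f ⊑? child h)) + ind (isLeaf h ∧ does (child g ⊑? child h))
                    ≤ ind (isLeaf h ∧ does (child e ⊑? child h))
    pointwise h with isLeaf h | child f ⊑? child h | child g ⊑? child h | child e ⊑? child h
    ... | false | _     | _     | _     = z≤n
    ... | true  | no _  | no _  | _     = z≤n
    ... | true  | yes p | yes q | _     = contradiction (siblings-disjoint (trans eqf (sym eqg)) p q) f≢g
    ... | true  | yes _ | no _  | yes _ = ℕₚ.≤-refl
    ... | true  | no _  | yes _ | yes _ = ℕₚ.≤-refl
    ... | true  | yes p | no _  | no ¬q = contradiction (⊑-trans (subst (_⊑ child f) eqf (par⊑child f)) p) ¬q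
    ... | true  | no _  | yes p | no ¬q = contradiction (⊑-trans (subst (_⊑ child g) eqg (par⊑child g)) p) ¬q

  heavy : Fin m → Maybe (Fin m)
  heavy e with argmax (λ f → par f ≟ child e) weight
  ... | inj₁ _       = nothing
  ... | inj₂ (f , _) = just f

  heavy-nothing : ∀ {e} → heavy e ≡ nothing → ∀ f → par f ≢ child e
  heavy-nothing {e} eq with argmax (λ f → par f ≟ child e) weight
  ... | inj₁ none = none

  heavy-just : ∀ {e f} → heavy e ≡ just f → par f ≡ child e × (∀ g → par g ≡ child e → weight g ≤ weight f)
  heavy-just {e} eq with argmax (λ f → par f ≟ child e) weight
  heavy-just refl | inj₂ (f , p , max) = p , max

  -- The partial inverse of `heavy`. The value `nothing` marks the top of a heavy path: an edge at
  -- the root or a light edge.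
  heavyParent : Fin m → Maybe (Fin m)
  heavyParent f with parentEdge (par f)
  ... | nothing = nothing
  ... | just e  = if does (≡-dec _≟_ (heavy e) (just f)) then just e else nothing

  heavy⇒heavyParent : ∀ {e f} → heavy e ≡ just f → heavyParent f ≡ just e
  heavy⇒heavyParent {e} {f} eq
    rewrite proj₁ (heavy-just eq) | parentEdge-child e | dec-true (≡-dec _≟_ (heavy e) (just f)) eq = refl

  heavyParent⇒heavy : ∀ {e f} → heavyParent f ≡ just e → heavy e ≡ just f
  heavyParent⇒heavy {e} {f} eq with parentEdge (par f)
  ... | just g with ≡-dec _≟_ (heavy g) (just f)
  heavyParent⇒heavy refl | just g | yes p = p

  isTop : Fin m → Bool
  isTop f = is-nothing (heavyParent f)

  isLeaf≡ : ∀ e → isLeaf e ≡ is-nothing (heavy e)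
  isLeaf≡ e with heavy e in eq
  ... | nothing = cong not (dec-false (hasChild? (child e)) λ { (f , p) → heavy-nothing eq f p })
  ... | just f  = cong not (dec-true (hasChild? (child e)) (f , proj₁ (heavy-just eq)))

  ∑-heavy : ∀ (v : Fin m → Fin m → ℕ) →
    ∑ (λ e → maybe (v e) 0 (heavy e)) ≡ ∑ (λ f → maybe (λ e → v e f) 0 (heavyParent f))
  ∑-heavy = sum-partialBijection ℕₚ.+-0-commutativeMonoid heavy heavyParent heavy⇒heavyParent heavyParent⇒heavy

  -- Equally many edges have a heavy parent as have a heavy child. The remaining edges are the tops
  -- and the leaf edges, respectively.
  #isTop≡#isLeaf : # isTop ≡ # isLeaf
  #isTop≡#isLeaf = ℕₚ.+-cancelʳ-≡ (∑ (λ f → maybe (λ _ → 1) 0 (heavyParent f))) _ _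
    (trans (sym (ℕΣ.∑-distrib-+ (λ f → ind (isTop f)) _))
    (trans (ℕΣ.sum-cong-≗ (λ f → trans (ind-is-nothing (heavyParent f)) (sym (ind-is-nothing (heavy f)))))
    (trans (ℕΣ.∑-distrib-+ (λ e → ind (is-nothing (heavy e))) _)
           (cong₂ _+_ (ℕΣ.sum-cong-≗ (λ e → cong ind (sym (isLeaf≡ e)))) (∑-heavy (λ _ _ → 1))))))

  -- A path to the root that meets a heavy path also contains its top, so this counts the heavy
  -- paths met on the way from `x` to the root.
  topsAbove : Fin n → ℕ
  topsAbove x = # λ f → isTop f ∧ does (child f ⊑? x)

  topsAbove-root : topsAbove root ≡ 0
  topsAbove-root = #-none (λ f → isTop f ∧ does (child f ⊑? root)) none
    where
    none : ∀ f → isTop f ∧ does (child f ⊑? root) ≡ false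
    none f rewrite dec-false (child f ⊑? root) (λ p → child≢root f (⊑-root⁻¹ p refl)) = ∧-zeroʳ (isTop f)

  topsAbove-child : ∀ f → topsAbove (child f) ≤ ind (isTop f) + topsAbove (par f)
  topsAbove-child f = ℕₚ.≤-trans (∑-mono pointwise) (ℕₚ.≤-reflexive
    (trans (ℕΣ.∑-distrib-+ (λ g → if does (f ≟ g) then ind (isTop g) else 0) _)
           (cong (_+ topsAbove (par f)) (sum-select ℕₚ.+-0-commutativeMonoid (just f) (ind ∘ isTop)))))
    where
    pointwise : ∀ g → ind (isTop g ∧ does (child g ⊑? child f))
      ≤ (if does (f ≟ g) then ind (isTop g) else 0) + ind (isTop g ∧ does (child g ⊑? par f))
    pointwise g with isTop g | child g ⊑? child f | child g ⊑? par f | f ≟ g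
    ... | false | _     | _     | _      = z≤n
    ... | true  | no _  | _     | _      = z≤n
    ... | true  | yes _ | _     | yes _  = s≤s z≤n
    ... | true  | yes _ | yes _ | no _   = ℕₚ.≤-refl
    ... | true  | yes p | no ¬q | no f≢g = contradiction (⊑-child⁻¹ p f refl) [ f≢g ∘ sym ∘ child-injective , ¬q ]′

  -- The heavy edge `g` below `e` differs from `f` and weighs at least as much, while both weights
  -- together are at most `weight e`.
  light-halves : ∀ {e f} → par f ≡ child e → heavyParent f ≡ nothing → 2 * weight f ≤ weight e
  light-halves {e} {f} eq light with heavy e in heavy-e
  ... | nothing = contradiction eq (heavy-nothing heavy-e f)
  ... | just g  = ℕₚ.≤-trans (ℕₚ.+-monoʳ-≤ (weight f)
                    (ℕₚ.≤-trans (ℕₚ.≤-reflexive (ℕₚ.+-identityʳ _)) (proj₂ (heavy-just heavy-e) f eq)))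
                    (weight-siblings eq (proj₁ (heavy-just heavy-e)) f≢g)
    where
    f≢g : f ≢ g
    f≢g refl with () ← trans (sym light) (heavy⇒heavyParent heavy-e)

  -- On the way down, a light edge doubles the power but at least halves the weight; a heavy edge
  -- increases neither. The factor 2 on the right pays for the first top, at the root, where no edge
  -- above provides a halving.
  2^topsAbove*weight : ∀ x e → child e ≡ x → 2 ^ topsAbove x * weight e ≤ 2 * # isLeaf
  2^topsAbove*weight = vertex-ind (λ x → ∀ e → child e ≡ x → 2 ^ topsAbove x * weight e ≤ 2 * # isLeaf)
    (λ e eq → contradiction eq (child≢root e)) step
    where
    open ℕₚ.≤-Reasoning
    bound : ∀ f → (∀ e → child e ≡ par f → 2 ^ topsAbove (par f) * weight e ≤ 2 * # isLeaf) →
      2 ^ topsAbove (child f) * weight f ≤ 2 * # isLeaf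
    bound f IH with rootOrChild (par f)
    ... | inj₁ up = begin
      2 ^ topsAbove (child f) * weight f  ≤⟨ ℕₚ.*-mono-≤ (ℕₚ.^-monoʳ-≤ 2 one) (weight≤#isLeaf f) ⟩
      2 * # isLeaf                        ∎
      where
      one : topsAbove (child f) ≤ 1
      one = begin
        topsAbove (child f)                  ≤⟨ topsAbove-child f ⟩
        ind (isTop f) + topsAbove (par f)    ≡⟨ cong (λ x → ind (isTop f) + topsAbove x) up ⟩
        ind (isTop f) + topsAbove root       ≡⟨ cong (ind (isTop f) +_) topsAbove-root ⟩
        ind (isTop f) + 0                    ≡⟨ ℕₚ.+-identityʳ _ ⟩
        ind (isTop f)                        ≤⟨ ind≤1 (isTop f) ⟩
        1                                    ∎
    ... | inj₂ (e , up) with heavyParent f in hp | topsAbove-child f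
    ...   | just _ | tops≤ = begin
      2 ^ topsAbove (child f) * weight f
        ≤⟨ ℕₚ.*-mono-≤ (ℕₚ.^-monoʳ-≤ 2 tops≤) (weight-mono (sym up)) ⟩
      2 ^ topsAbove (par f) * weight e     ≤⟨ IH e up ⟩
      2 * # isLeaf                         ∎
    ...   | nothing | tops≤ = begin
      2 ^ topsAbove (child f) * weight f         ≤⟨ ℕₚ.*-monoˡ-≤ (weight f) (ℕₚ.^-monoʳ-≤ 2 tops≤) ⟩
      2 * 2 ^ topsAbove (par f) * weight f       ≡⟨ cong (_* weight f) (ℕₚ.*-comm 2 (2 ^ topsAbove (par f))) ⟩
      2 ^ topsAbove (par f) * 2 * weight f       ≡⟨ ℕₚ.*-assoc (2 ^ topsAbove (par f)) 2 (weight f) ⟩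
      2 ^ topsAbove (par f) * (2 * weight f)     ≤⟨ ℕₚ.*-monoʳ-≤ (2 ^ topsAbove (par f)) (light-halves (sym up) hp) ⟩
      2 ^ topsAbove (par f) * weight e           ≤⟨ IH e up ⟩
      2 * # isLeaf                               ∎
    step : ∀ f → (∀ e → child e ≡ par f → 2 ^ topsAbove (par f) * weight e ≤ 2 * # isLeaf) →
      ∀ e → child e ≡ child f → 2 ^ topsAbove (child f) * weight e ≤ 2 * # isLeaf
    step f IH e eq with refl ← child-injective eq = bound f IH

  2^topsAbove≤ : 1 ≤ # isLeaf → ∀ x → 2 ^ topsAbove x ≤ 2 * # isLeaf
  2^topsAbove≤ pos x with rootOrChild x
  ... | inj₁ up rewrite up | topsAbove-root = ℕₚ.≤-trans pos (ℕₚ.m≤m+n _ _)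
  ... | inj₂ (e , up) = ℕₚ.≤-trans (ℕₚ.≤-reflexive (sym (ℕₚ.*-identityʳ _)))
                   (ℕₚ.≤-trans (ℕₚ.*-monoʳ-≤ (2 ^ topsAbove x) (weight≥1 e))
                     (2^topsAbove*weight x e up))

-- Alternating signs and telescoping along heavy paths

module Alternating {n m : ℕ} {ends : Fin m → Fin n × Fin n} (Rt : Rooted ends) (c : Fin m → Bool) where
  open Rooted Rt
  open RootedTree Rt
  open HeavyPaths Rt

  depth-heavy : ∀ {e f} → heavy e ≡ just f → depth (child f) ≡ suc (depth (child e))
  depth-heavy {e} {f} eq = trans (depth-child f) (cong (λ x → suc (depth x)) (proj₁ (heavy-just eq)))

  -- The recursion climbs to the top of the heavy path. The depth serves as fuel because it drops by
  -- exactly one at each heavy parent.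
  signFrom : ℕ → Fin m → Bool
  signFrom zero    f = c f
  signFrom (suc k) f = maybe (λ e → not (signFrom k e)) (c f) (heavyParent f)

  sign : Fin m → Bool
  sign f = signFrom (depth (child f)) f

  sign-heavy : ∀ {e f} → heavy e ≡ just f → sign f ≡ not (sign e)
  sign-heavy {e} {f} eq rewrite depth-heavy eq | heavy⇒heavyParent eq = refl

  sign-top : ∀ {f} → heavyParent f ≡ nothing → sign f ≡ c f
  sign-top {f} eq rewrite depth-child f | eq = refl

  module Telescope (Q : Fin m → Bool) where

    -- This sum bounds every depth, so `suc depthBound ∸ depth (child e)` is positive fuel that
    -- drops by one with each step down a heavy path.
    depthBound : ℕ
    depthBound = ∑ (λ e → depth (child e))

    oddFrom : ℕ → Fin m → Bool
    oddFrom zero    e = false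
    oddFrom (suc k) e = Q e ∧ not (maybe (oddFrom k) false (heavy e))

    -- Whether the run of edges of Q that starts at e and goes down its heavy path has odd length.
    odd : Fin m → Bool
    odd e = oddFrom (suc depthBound ∸ depth (child e)) e

    oddBelow : Fin m → Bool
    oddBelow e = maybe odd false (heavy e)

    odd≡ : ∀ e → odd e ≡ Q e ∧ not (oddBelow e)
    odd≡ e rewrite ℕₚ.+-∸-assoc 1 (term≤∑ (λ e → depth (child e)) e) with heavy e in eq
    ... | nothing = refl
    ... | just f rewrite depth-heavy eq = refl

    term : Fin m → ℤ
    term e = if Q e then sgn (sign e) else ℤ.+ 0

    -- The signed sum of the run of `Q` from `e` downwards: alternating signs cancel in pairs and
    -- leave the first one if the length is odd.
    oddTerm : Fin m → ℤ
    oddTerm e = if odd e then sgn (sign e) else ℤ.+ 0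

    next : Fin m → Fin m → ℤ
    next e f = ℤ.- (if Q e then oddTerm f else ℤ.+ 0)

    -- A single term is the difference of the run sums at `e` and at the next edge of its heavy
    -- path.
    term≡ : ∀ e → term e ≡ oddTerm e ℤ.+ maybe (next e) (ℤ.+ 0) (heavy e)
    term≡ e rewrite odd≡ e with Q e | heavy e in eq
    ... | false | nothing = refl
    ... | false | just f  = refl
    ... | true  | nothing with sign e
    ...   | true  = refl
    ...   | false = refl
    term≡ e | true | just f rewrite sign-heavy eq with odd f | sign e
    ...   | true  | true  = refl
    ...   | true  | false = refl
    ...   | false | true  = refl
    ...   | false | false = refl

    start : Fin m → ℤ
    start f = oddTerm f ℤ.+ maybe (λ e → next e f) (ℤ.+ 0) (heavyParent f)

    -- Reindexing moves each subtracted run sum to the edge `f` where that run begins. There it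
    -- cancels `oddTerm f` unless `f` is a top or its heavy parent is outside `Q`.
    ∑term≡∑start : ∑ℤ term ≡ ∑ℤ start
    ∑term≡∑start = trans (ℤΣ.sum-cong-≗ term≡) (trans (ℤΣ.∑-distrib-+ oddTerm _)
      (trans (cong (ℤ._+_ (∑ℤ oddTerm))
        (sum-partialBijection ℤₚ.+-0-commutativeMonoid heavy heavyParent heavy⇒heavyParent heavyParent⇒heavy next))
        (sym (ℤΣ.∑-distrib-+ oddTerm _))))

    -- Besides the tops, only at these edges does a segment of Q on a heavy path start.
    isBroken : Fin m → Bool
    isBroken f = Q f ∧ maybe (λ e → not (Q e)) false (heavyParent f)

    topWith : Bool → Fin m → Bool
    topWith b f = (isTop f ∧ Q f) ∧ does (c f ≟B b)

    -- A maximal run contributes 0 or the sign of its first edge. At a top this sign is `c f`, so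
    -- each direction is charged to tops of one colour; a run that starts lower is charged in both
    -- directions.
    start-bound : ∀ f → start f ℤ.≤ ℤ.+ (ind (topWith true f) + ind (isBroken f))
                      × ℤ.- start f ℤ.≤ ℤ.+ (ind (topWith false f) + ind (isBroken f))
    start-bound f rewrite odd≡ f with Q f | oddBelow f | heavyParent f in eq
    ... | false | _    | nothing = ℤₚ.≤-refl , ℤₚ.≤-refl
    ... | true  | true | nothing = ℤ.+≤+ z≤n , ℤ.+≤+ z≤n
    ... | true  | false | nothing rewrite sign-top eq with c f
    ...   | true  = ℤₚ.≤-refl , ℤ.-≤+
    ...   | false = ℤ.-≤+ , ℤₚ.≤-refl
    start-bound f | q | p | just e with Q e
    start-bound f | true  | false | just e | true with sign f
    ...   | true  = ℤₚ.≤-refl , ℤₚ.≤-refl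
    ...   | false = ℤₚ.≤-refl , ℤₚ.≤-refl
    start-bound f | true  | true  | just e | true = ℤₚ.≤-refl , ℤₚ.≤-refl
    start-bound f | false | p     | just e | true = ℤₚ.≤-refl , ℤₚ.≤-refl
    start-bound f | true  | false | just e | false with sign f
    ...   | true  = ℤₚ.≤-refl , ℤ.-≤+
    ...   | false = ℤ.-≤+ , ℤₚ.≤-refl
    start-bound f | true  | true  | just e | false = ℤ.+≤+ z≤n , ℤ.+≤+ z≤n
    start-bound f | false | p     | just e | false = ℤₚ.≤-refl , ℤₚ.≤-refl

    ∣∑term∣-bound : ∀ {N} → # topWith true ≤ N → # topWith false ≤ N → # isBroken ≤ 1 → ∣ ∑ℤ term ∣ ≤ N + 1
    ∣∑term∣-bound {N} T F B = subst (λ z → ∣ z ∣ ≤ N + 1) (sym ∑term≡∑start)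
      (∣∑ℤ∣-bound (λ f → proj₁ (start-bound f)) (λ f → proj₂ (start-bound f)) (both T) (both F))
      where
      both : ∀ {P} → # P ≤ N → ∑ (λ f → ind (P f) + ind (isBroken f)) ≤ N + 1
      both {P} le = ℕₚ.≤-trans (ℕₚ.≤-reflexive (ℕΣ.∑-distrib-+ (λ f → ind (P f)) _)) (ℕₚ.+-mono-≤ le B)

-- Walks in a subtree

module _ {n m : ℕ} {ends : Fin m → Fin n × Fin n} (Rt : Rooted ends) where
  open Rooted Rt
  open RootedTree Rt

  module Walks {S : Fin m → Bool} where

    DAdj⁻¹ : ∀ {τ x y} → DAdj ends S τ x y → Σ (Fin m) λ e → S e ≡ true ×
      ((τ e ≡ down e × par e ≡ x × child e ≡ y) ⊎ (τ e ≡ not (down e) × child e ≡ x × par e ≡ y))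
    DAdj⁻¹ {τ} (e , Se , t , h) = e , Se , direction t h
      where
      direction : ∀ {x y} → tail ends τ e ≡ x → head ends τ e ≡ y →
        (τ e ≡ down e × par e ≡ x × child e ≡ y) ⊎ (τ e ≡ not (down e) × child e ≡ x × par e ≡ y)
      direction t h rewrite ends≡ e with τ e | down e
      ... | true  | true  = inj₁ (refl , t , h)
      ... | true  | false = inj₂ (refl , t , h)
      ... | false | true  = inj₂ (refl , t , h)
      ... | false | false = inj₁ (refl , t , h)

    Adj⁻¹ : ∀ {x y} → Adj ends S x y → Σ (Fin m) λ e → S e ≡ true ×
      ((par e ≡ x × child e ≡ y) ⊎ (child e ≡ x × par e ≡ y))
    Adj⁻¹ (e , Se , p) = e , Se , direction p
      where
      direction : ∀ {x y} → ends e ≡ (x , y) ⊎ ends e ≡ (y , x) → (par e ≡ x × child e ≡ y) ⊎ (child e ≡ x × par e ≡ y)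
      direction p rewrite ends≡ e with down e | p
      ... | true  | inj₁ refl = inj₁ (refl , refl)
      ... | true  | inj₂ refl = inj₂ (refl , refl)
      ... | false | inj₁ refl = inj₂ (refl , refl)
      ... | false | inj₂ refl = inj₁ (refl , refl)

    -- The edge `f` is the only connection between the vertices below it and the rest, so the step
    -- that enters crosses `f` downwards. `leaving⇒up` is the mirror image.
    entering⇒down : ∀ {τ f x y} → Star (DAdj ends S τ) x y → ¬ child f ⊑ x → child f ⊑ y → τ f ≡ down f
    entering⇒down ε out in′ = contradiction in′ out
    entering⇒down {f = f} (_◅_ {j = z} step walk) out in′ with child f ⊑? z | DAdj⁻¹ step
    ... | no  z-out | _ = entering⇒down walk z-out in′
    ... | yes z-in | e , _ , inj₂ (_ , refl , refl) = contradiction (under e z-in) out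
    ... | yes z-in | e , _ , inj₁ (τe , refl , refl) with ⊑-child⁻¹ z-in e refl
    ...   | inj₂ p  = contradiction p out
    ...   | inj₁ eq with refl ← child-injective eq = τe

    leaving⇒up : ∀ {τ f x y} → Star (DAdj ends S τ) x y → child f ⊑ x → ¬ child f ⊑ y → τ f ≡ not (down f)
    leaving⇒up ε in′ out = contradiction in′ out
    leaving⇒up {f = f} (_◅_ {j = z} step walk) in′ out with child f ⊑? z | DAdj⁻¹ step
    ... | yes z-in  | _ = leaving⇒up walk z-in out
    ... | no  z-out | e , _ , inj₁ (_ , refl , refl) = contradiction (under e in′) z-out
    ... | no  z-out | e , _ , inj₂ (τe , refl , refl) with ⊑-child⁻¹ in′ e refl
    ...   | inj₂ p  = contradiction p z-out
    ...   | inj₁ eq with refl ← child-injective eq = τe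

    -- If `f` lies on the path from `r` to the root, the walk from `r` to `par f` leaves the part
    -- below `f`; otherwise the walk to `child f` enters it.
    rootedAway⇒direction : ∀ {r τ} → RootedAway ends S r τ → ∀ f → S f ≡ true →
      τ f ≡ (if does (child f ⊑? r) then not (down f) else down f)
    rootedAway⇒direction {r} (_ , reach) f Sf with child f ⊑? r
    ... | yes p = leaving⇒up (reach (par f) (incident-par f Sf)) p (child⋢par f)
    ... | no ¬p = entering⇒down (reach (child f) (incident-child f Sf)) ¬p here

    -- The only exit from the part below `e` is `e` itself, which `S` does not contain.
    walk-stays-below : ∀ {e x y} → S e ≡ false → Star (Adj ends S) x y → child e ⊑ x → child e ⊑ y
    walk-stays-below Se ε p = p
    walk-stays-below {e} Se (step ◅ walk) p with Adj⁻¹ step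
    ... | f , _  , inj₁ (refl , refl) = walk-stays-below Se walk (under f p)
    ... | f , Sf , inj₂ (refl , refl) with ⊑-child⁻¹ p f refl
    ...   | inj₂ q  = walk-stays-below Se walk q
    ...   | inj₁ eq with refl ← child-injective eq with () ← trans (sym Sf) Se

-- Upper bound

module UpperBound {n m : ℕ} {ends : Fin m → Fin n × Fin n} (Rt : Rooted ends) where
  open Rooted Rt
  open RootedTree Rt
  open HeavyPaths Rt
  open Walks Rt

  c : Fin m → Bool
  c = proj₁ (balanced isTop)

  open Alternating Rt c

  σ : Fin m → Bool
  σ f = if sign f then down f else not (down f)

  module _ {S : Fin m → Bool} {r : Fin n} {τ : Fin m → Bool}
      (connected : ConnectedEdgeSet ends S) (away : RootedAway ends S r τ) where

    S∩path : Fin m → Bool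
    S∩path f = S f ∧ does (child f ⊑? r)

    module Whole = Telescope S
    module Path  = Telescope S∩path

    broken⁻¹ : ∀ {f} → Whole.isBroken f ≡ true → S f ≡ true × Σ (Fin m) λ e → heavy e ≡ just f × S e ≡ false
    broken⁻¹ {f} br with S f | heavyParent f in eq
    ... | true | just e with S e in Se
    ...   | false = refl , e , heavyParent⇒heavy eq , Se

    -- The missing edge above a broken edge confines the connected set `S` to the part below it. For
    -- two such missing edges the lower ends lie below each other, so the edges coincide, and so do
    -- their heavy children.
    broken-unique : ∀ {f g} → Whole.isBroken f ≡ true → Whole.isBroken g ≡ true → f ≡ g
    broken-unique {f} {g} brf brg with broken⁻¹ brf | broken⁻¹ brg
    ... | Sf , e , hf , Se | Sg , d , hg , Sd = just-injective (trans (sym hf) (trans (cong heavy e≡d) hg))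
      where
      pf = proj₁ (heavy-just hf)
      pg = proj₁ (heavy-just hg)
      walk : ∀ {x y} → par f ≡ x → par g ≡ y → Star (Adj ends S) x y × Star (Adj ends S) y x
      walk refl refl = connected _ _ (incident-par f Sf) (incident-par g Sg)
                     , connected _ _ (incident-par g Sg) (incident-par f Sf)
      e≡d : e ≡ d
      e≡d = child-injective (⊑-antisym (walk-stays-below Se (proj₁ (walk pf pg)) here)
                                       (walk-stays-below Sd (proj₂ (walk pf pg)) here))

    -- With `f`, its heavy parent also lies on the path from `r` to the root, so it can only be
    -- missing because it is outside `S`.
    path-broken⇒broken : ∀ f → Path.isBroken f ≡ true → Whole.isBroken f ≡ true
    path-broken⇒broken f br with S f | child f ⊑? r | heavyParent f in eq
    ... | true | yes p | just e with S e
    ...   | false = refl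
    ...   | true rewrite dec-true (child e ⊑? r)
              (⊑-trans (subst (_⊑ child f) (proj₁ (heavy-just (heavyParent⇒heavy eq))) (par⊑child f)) p)
              with () ← br

    #broken≤1 : # Whole.isBroken ≤ 1
    #broken≤1 = #-unique Whole.isBroken broken-unique

    #path-broken≤1 : # Path.isBroken ≤ 1
    #path-broken≤1 = #-unique Path.isBroken
      (λ p q → broken-unique (path-broken⇒broken _ p) (path-broken⇒broken _ q))

    -- On the path from `r` to the root `τ` points upwards, which negates the sign of an edge, that
    -- is, subtracts it twice; elsewhere the sign is counted as it is.
    orientedSum≡ : orientedSum ends σ S τ ≡ ∑ℤ Whole.term ℤ.- (∑ℤ Path.term ℤ.+ ∑ℤ Path.term)
    orientedSum≡ = trans (foldr-tabulate {m} _) (trans (ℤΣ.sum-cong-≗ pointwise)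
      (trans (ℤΣ.∑-distrib-+ Whole.term (λ f → ℤ.- (Path.term f ℤ.+ Path.term f)))
        (cong (ℤ._+_ (∑ℤ Whole.term)) (trans (∑ℤ-neg (λ f → Path.term f ℤ.+ Path.term f))
          (cong ℤ.-_ (ℤΣ.∑-distrib-+ Path.term Path.term))))))
      where
      pointwise : ∀ f → (if S f then (if does (σ f ≟B τ f) then ℤ.+ 1 else ℤ.- (ℤ.+ 1)) else ℤ.+ 0)
                      ≡ Whole.term f ℤ.- (Path.term f ℤ.+ Path.term f)
      pointwise f with S f | rootedAway⇒direction away f
      ... | false | _ = refl
      ... | true | dir rewrite dir refl with does (child f ⊑? r) | sign f | down f
      ...   | true  | true  | true  = refl
      ...   | true  | true  | false = refl
      ...   | true  | false | true  = refl
      ...   | true  | false | false = refl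
      ...   | false | true  | true  = refl
      ...   | false | true  | false = refl
      ...   | false | false | true  = refl
      ...   | false | false | false = refl
    open ℕₚ.≤-Reasoning

    #tops : Bool → ℕ
    #tops true  = # λ f → isTop f ∧ c f
    #tops false = # λ f → isTop f ∧ not (c f)

    Whole-tops : ∀ b → # Whole.topWith b ≤ #tops b
    Whole-tops true = ∑-mono pointwise
      where
      pointwise : ∀ f → ind (Whole.topWith true f) ≤ ind (isTop f ∧ c f)
      pointwise f with isTop f | S f | c f
      ... | false | _     | _     = z≤n
      ... | true  | false | _     = z≤n
      ... | true  | true  | true  = ℕₚ.≤-refl
      ... | true  | true  | false = z≤n
    Whole-tops false = ∑-mono pointwise
      where
      pointwise : ∀ f → ind (Whole.topWith false f) ≤ ind (isTop f ∧ not (c f))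
      pointwise f with isTop f | S f | c f
      ... | false | _     | _     = z≤n
      ... | true  | false | _     = z≤n
      ... | true  | true  | false = ℕₚ.≤-refl
      ... | true  | true  | true  = z≤n

    Path-tops : ∀ b → # Path.topWith b ≤ topsAbove r
    Path-tops b = ∑-mono pointwise
      where
      pointwise : ∀ f → ind (Path.topWith b f) ≤ ind (isTop f ∧ does (child f ⊑? r))
      pointwise f with isTop f | S f | does (child f ⊑? r)
      ... | false | _     | _     = z≤n
      ... | true  | false | _     = z≤n
      ... | true  | true  | true  = ind≤1 _
      ... | true  | true  | false = z≤n

    #tops-total : #tops true + #tops false ≡ # isTop
    #tops-total = trans (sym (ℕΣ.∑-distrib-+ (λ f → ind (isTop f ∧ c f)) _)) (ℕΣ.sum-cong-≗ pointwise)
      where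
      pointwise : ∀ f → ind (isTop f ∧ c f) + ind (isTop f ∧ not (c f)) ≡ ind (isTop f)
      pointwise f with isTop f | c f
      ... | false | _     = refl
      ... | true  | true  = refl
      ... | true  | false = refl

    N : ℕ
    N = #tops true ⊔ #tops false

    2N≤ : 2 * N ≤ suc (# isLeaf)
    2N≤ = begin
      2 * N                          ≤⟨ 2*⊔≤ (proj₁ (proj₂ (balanced isTop))) (proj₂ (proj₂ (balanced isTop))) ⟩
      suc (#tops true + #tops false) ≡⟨ cong suc (trans #tops-total #isTop≡#isLeaf) ⟩
      suc (# isLeaf)                 ∎

    discrepancy-bound : 2 * ∣ orientedSum ends σ S τ ∣ ≤ # isLeaf + (4 * topsAbove r + 7)
    discrepancy-bound = error-arithmetic N (topsAbove r) 2N≤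
      (Whole.∣∑term∣-bound
        (ℕₚ.≤-trans (Whole-tops true)  (ℕₚ.m≤m⊔n (#tops true) (#tops false)))
        (ℕₚ.≤-trans (Whole-tops false) (ℕₚ.m≤n⊔m (#tops true) (#tops false))) #broken≤1)
      (Path.∣∑term∣-bound (Path-tops true) (Path-tops false) #path-broken≤1)
      (subst (λ z → ∣ z ∣ ≤ ∣ ∑ℤ Whole.term ∣ + (∣ ∑ℤ Path.term ∣ + ∣ ∑ℤ Path.term ∣)) (sym orientedSum≡)
        (ℕₚ.≤-trans (ℤₚ.∣i-j∣≤∣i∣+∣j∣ (∑ℤ Whole.term) (∑ℤ Path.term ℤ.+ ∑ℤ Path.term))
          (ℕₚ.+-monoʳ-≤ ∣ ∑ℤ Whole.term ∣ (ℤₚ.∣i+j∣≤∣i∣+∣j∣ (∑ℤ Path.term) (∑ℤ Path.term)))))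

  atMost : ∀ k → threshold (suc k) ≤ leaves ends →
    ∀ S r τ → ConnectedEdgeSet ends S → RootedAway ends S r τ →
    2 * suc k * ∣ orientedSum ends σ S τ ∣ ≤ suc (suc k) * leaves ends
  atMost k large S r τ connected away = upper-arithmetic k
    {leaves ends} {# isLeaf} {∣ orientedSum ends σ S τ ∣} {4 * topsAbove r + 7} #isLeaf≤leaves
    (discrepancy-bound {S} {r} {τ} connected away)
    (logarithmic-error (suc k) {leaves ends} {topsAbove r} large
      (ℕₚ.≤-trans (2^topsAbove≤ (2≤leaves⇒1≤#isLeaf (ℕₚ.≤-trans (2≤threshold k) large)) r)
                  (ℕₚ.*-monoʳ-≤ 2 #isLeaf≤leaves)))

-- Division by `2(k + 1)ℓ` places the ratio of the discrepancy to `ℓ` within `1/(2(k + 1))` of one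
-- half. As `k` is arbitrary and `L` depends on `k` alone, this is the uniform `o(1)`.
theorem1p4 : (k : ℕ) → Σ ℕ λ L → (T : Tree) → numLeaves T ≥ L →
    OrDiscAtLeast T (k * numLeaves T) (2 * suc k)
    × OrDiscAtMost T (suc (suc k) * numLeaves T) (2 * suc k)
theorem1p4 k = threshold (suc k) , λ T large →
    (λ σ → LowerBound.atLeast (rooted T) σ k large)
  , UpperBound.σ (rooted T) , UpperBound.atMost (rooted T) k large
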